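{- Let $n\ge 1$. The bookshelf construction $T\mapsto B(T)$ is a bijection from the set of binary trees with $n+1$ leaves to the set of Young diagrams $\lambda=(\lambda_1\ge\lambda_2\ge\cdots)$ satisfying $\lambda_i+i\le n$ for all $1\le i\le n$ (so in particular $\lambda_i=0$ for all $i\ge n$).
   Context: A binary tree is a finite planar rooted tree in which every internal node has exactly two children (a left child and a right child). A Young diagram is a weakly decreasing sequence $\lambda_1\ge\lambda_2\ge\cdots\ge 0$ of integers with finitely many nonzero terms, where $\lambda_i$ is the number of boxes in row $i$; the empty diagram is allowed. Coordinates. Let $T$ be a binary tree with $n+1$ leaves, drawn so that all leaves lie on the bottom level. A node $v$ of $T$ (internal or leaf) has coordinates $(m,k)$, where $m$ is the number of leaves of $T$ strictly to the right of all leaves of the subtree rooted at $v$, and $k$ is the number of leaves of $T$ strictly to the left of all leaves of that subtree. Thus the root is at $(0,0)$ and leaves are at the points $(m,n-m)$, $0\le m\le n$. Edges to right children are descending (they keep the first coordinate $m$ constant), and edges to left children are ascending (read from left to right; they keep the second coordinate constant). Shelves. A maximal descending segment of $T$ with constant first coordinate $m$ runs from a point $(m,k)$ to the leaf $(m,n-m)$. The one with $m=0$ (starting at the root) is called the ceiling. Those of positive length with $m\ge 1$ are called shelves; equivalently, a shelf with first coordinate $m\ge1$ starts at the highest node whose subtree's rightmost leaf is $(m,n-m)$, when that node is not itself the leaf. Bookshelf construction. Let the cell $(i,c)$ (row $i\ge1$, column $c\ge1$) be the unit square with corners $(i-1,c-1),(i-1,c),(i,c-1),(i,c)$. For each shelf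 from $(m,k)$ to $(m,n-m)$, fill in all cells $(i,c)$ with $1\le i\le m$ and $k+1\le c\le n-m$ (all cells above the shelf up to the ceiling). Take the union of these sets of cells over all shelves, and then push the cells of each row to the left so as to eliminate gaps. The result is a Young diagram $B(T)$: its $i$-th row length is the number of filled cells in row $i$. -}

module Defs where

open import Data.Nat using (ℕ; suc; _+_; _∸_; _≤_; _<_; z≤n; s≤s; _≟_; _≤?_; _<?_)
open import Data.Nat.Properties using (≤-refl; ≤-trans; m≤n⇒m≤1+n; m≤n⇒m∸n≡0)
open import Data.List using (length; filter; applyUpTo)
open import Data.List.Properties using (filter-none)
open import Data.List.Relation.Unary.All using (universal)
open import Data.List.Relation.Binary.Sublist.Propositional using (⊆-refl)
open import Data.List.Relation.Binary.Sublist.Propositional.Properties using (filter⁺; length-mono-≤)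
open import Data.Product using (Σ; ∃; _×_; _,_; Σ-syntax; ∃-syntax)
open import Data.Tree.Binary using (Tree; leaf; node; #leaves)
open import Data.Unit using (⊤; tt)
open import Relation.Nullary using (Dec; yes; no; ¬_)
open import Relation.Nullary.Decidable using (_×-dec_; _→-dec_)
open import Relation.Unary using (Decidable)
open import Relation.Binary.PropositionalEquality using (_≡_; refl; cong; subst)

Shape : Set
Shape = Tree ⊤ ⊤

BinaryTree : ℕ → Set
BinaryTree n = Σ[ t ∈ Shape ] #leaves t ≡ suc n

-- Nodes of a tree, internal nodes and leaves alike, as paths from the root.
data Node : Shape → Set where
  root  : ∀ {t} → Node t
  left  : ∀ {l r} → Node l → Node (node l tt r)
  right : ∀ {l r} → Node r → Node (node l tt r)

-- The coordinates (m , k) of a node: the number of leaves strictly to the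
-- right, respectively to the left, of its subtree.
m-coord : ∀ {t} → Node t → ℕ
m-coord root             = 0
m-coord (left {r = r} v) = m-coord v + #leaves r
m-coord (right v)        = m-coord v

k-coord : ∀ {t} → Node t → ℕ
k-coord root              = 0
k-coord (left v)          = k-coord v
k-coord (right {l = l} v) = #leaves l + k-coord v

-- The nodes with first coordinate m form a descending segment ending at the
-- leaf (m , n ∸ m), where n + 1 is the number of leaves.  `IsShelf n v` says
-- that v is the top of the segment through v, that the segment has positive
-- length, and that it is not the ceiling m = 0.
IsShelf : ℕ → ∀ {t} → Node t → Set
IsShelf n {t} v =
  1 ≤ m-coord v ×
  k-coord v < n ∸ m-coord v ×
  (∀ (w : Node t) → m-coord w ≡ m-coord v → k-coord v ≤ k-coord w)

-- Cells (i , c) are indexed from 1, before the rows are pushed to the left.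
Filled : ℕ → Shape → ℕ → ℕ → Set
Filled n t i c = Σ[ v ∈ Node t ]
  IsShelf n v ×
  (1 ≤ i × i ≤ m-coord v) ×
  (k-coord v + 1 ≤ c × c ≤ n ∸ m-coord v)

anyNode? : ∀ t {P : Node t → Set} → Decidable P → Dec (∃ P)
anyNode? t P? with P? root
... | yes p = yes (root , p)
anyNode? (leaf tt) P? | no ¬p = no λ { (root , p) → ¬p p }
anyNode? (node l tt r) P? | no ¬p
  with anyNode? l (λ v → P? (left v)) | anyNode? r (λ v → P? (right v))
... | yes (v , p) | _           = yes (left v , p)
... | no _        | yes (v , p) = yes (right v , p)
... | no ¬l       | no ¬r       = no λ
  { (root , p) → ¬p p ; (left v , p) → ¬l (v , p) ; (right v , p) → ¬r (v , p) }

allNodes? : ∀ t {P : Node t → Set} → Decidable P → Dec (∀ v → P v)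
allNodes? t P? with P? root
... | no ¬p = no λ f → ¬p (f root)
allNodes? (leaf tt) P? | yes p = yes λ { root → p }
allNodes? (node l tt r) P? | yes p
  with allNodes? l (λ v → P? (left v)) | allNodes? r (λ v → P? (right v))
... | no ¬l | _     = no λ f → ¬l (λ v → f (left v))
... | yes _ | no ¬r = no λ f → ¬r (λ v → f (right v))
... | yes f | yes g = yes λ { root → p ; (left v) → f v ; (right v) → g v }

isShelf? : ∀ n {t} → Decidable (IsShelf n {t})
isShelf? n {t} v =
  (1 ≤? m-coord v) ×-dec
  (k-coord v <? n ∸ m-coord v) ×-dec
  allNodes? t (λ w → (m-coord w ≟ m-coord v) →-dec (k-coord v ≤? k-coord w))

filled? : ∀ n t i c → Dec (Filled n t i c)
filled? n t i c = anyNode? t λ v →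
  isShelf? n v ×-dec
  ((1 ≤? i) ×-dec (i ≤? m-coord v)) ×-dec
  ((k-coord v + 1 ≤? c) ×-dec (c ≤? n ∸ m-coord v))

-- The number of filled cells in row i.  A filled cell has 1 ≤ c ≤ n, so it
-- suffices to count over the columns 1, …, n.
rowLength : ℕ → Shape → ℕ → ℕ
rowLength n t i = length (filter (filled? n t i) (applyUpTo suc n))

-- The rows λ₁ ≥ λ₂ ≥ ⋯ are indexed from 0 here: `row i` is λ_{i+1}.
record YoungDiagram : Set where
  field
    row        : ℕ → ℕ
    decreasing : ∀ i → row (suc i) ≤ row i
    finite     : ∃[ N ] (∀ i → N ≤ i → row i ≡ 0)

open YoungDiagram public

infix 4 _≈_
_≈_ : YoungDiagram → YoungDiagram → Set
μ ≈ ν = ∀ i → row μ i ≡ row ν i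

-- λ_i + i ≤ n for 1 ≤ i ≤ n, with i written as suc i.
Fits : ℕ → YoungDiagram → Set
Fits n μ = ∀ i → suc i ≤ n → row μ i + suc i ≤ n

FittingDiagram : ℕ → Set
FittingDiagram n = Σ YoungDiagram (Fits n)

_≈ᶠ_ : ∀ {n} → FittingDiagram n → FittingDiagram n → Set
(μ , _) ≈ᶠ (ν , _) = μ ≈ ν

filled-up : ∀ n t i c → Filled n t (suc (suc i)) c → Filled n t (suc i) c
filled-up n t i c (v , s , (_ , p) , q) =
  v , s , (s≤s z≤n , ≤-trans (m≤n⇒m≤1+n ≤-refl) p) , q

not-filled : ∀ n t i c → n ≤ i → ¬ Filled n t i c
not-filled n t i c n≤i (v , (_ , k<n∸m , _) , (_ , i≤m) , _)
  with subst (k-coord v <_) (m≤n⇒m∸n≡0 (≤-trans n≤i i≤m)) k<n∸m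
... | ()

B : ∀ {n} → BinaryTree n → YoungDiagram
B {n} (t , _) = record
  { row        = λ i → rowLength n t (suc i)
  ; decreasing = λ i → length-mono-≤
      (filter⁺ (filled? n t (suc (suc i))) (filled? n t (suc i))
        (λ { {c} refl → filled-up n t i c }) (⊆-refl {x = applyUpTo suc n}))
  ; finite     = n , λ i n≤i → cong length
      (filter-none (filled? n t (suc i))
        (universal (λ c → not-filled n t (suc i) c (m≤n⇒m≤1+n n≤i)) (applyUpTo suc n)))
  }

{-# OPTIONS --safe #-}

-- Let ρ(T, i) be the number of filled cells in row i, extended to i = 0 by
-- ρ(T, 0) = n.  If T has left subtree L and right subtree R, with r internal
-- nodes in R, then
--   ρ(T, i + 1) = ρ(L, i ∸ r) + ρ(R, i + 1),
-- since the column between the leaves of L and those of R is not filled in any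
-- row i ≥ 1.  Hence r + 1 is the least i ≥ 1 at which ρ(T, i) + i attains its
-- maximal value n; cutting the diagram at that row recovers the diagrams of
-- both subtrees, and by induction T itself.

module Submission where

open import Defs
open import Algebra.Properties.CommutativeSemigroup using (xy∙z≈xz∙y; x∙yz≈y∙xz)
open import Data.List using (length; filter; applyUpTo; _∷_; _++_)
open import Data.List.Properties using (length-++; length-applyUpTo; filter-++; filter-all; filter-reject)
open import Data.List.Relation.Unary.All.Properties using (applyUpTo⁺₁)
open import Data.Nat using (ℕ; zero; suc; _+_; _∸_; _≤_; _<_; z≤n; s≤s; s≤s⁻¹; z<s)
open import Data.Nat.Induction using (Acc; acc; <-wellFounded)
open import Data.Nat.Properties
open import Data.Product using (Σ-syntax; ∃-syntax; _×_; _,_; proj₁; proj₂)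
open import Data.Sum using (_⊎_; inj₁; inj₂)
open import Data.Tree.Binary using (leaf; node; #leaves; #nodes)
open import Data.Unit using (tt)
open import Function using (_∘_)
open import Function.Definitions using (Bijective)
open import Relation.Binary.PropositionalEquality
  using (_≡_; refl; sym; trans; cong; cong₂; subst; module ≡-Reasoning)
open import Relation.Nullary using (¬_; yes; no; contradiction)
open import Relation.Nullary.Decidable using (_×-dec_)
open import Relation.Unary using (Decidable)

-- Row sizes by recursion on the tree

#leaves≡1+#nodes : ∀ (t : Shape) → #leaves t ≡ suc (#nodes t)
#leaves≡1+#nodes (leaf tt)     = refl
#leaves≡1+#nodes (node l tt r) = cong₂ _+_ (#leaves≡1+#nodes l) (#leaves≡1+#nodes r)

-- Row 0 is a fictitious full row. Truncated subtraction sends rows 1 to `suc (#nodes r)` there,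
-- because in these rows the segment descending from the root of `l` covers all `#nodes l` columns
-- of `l`.
rowSize : Shape → ℕ → ℕ
rowSize t             zero    = #nodes t
rowSize (leaf tt)     (suc i) = 0
rowSize (node l tt r) (suc i) = rowSize l (i ∸ #nodes r) + rowSize r (suc i)

<-or-offset : ∀ i n → i < n ⊎ ∃[ j ] i ≡ n + j
<-or-offset i n with i <? n
... | yes i<n = inj₁ i<n
... | no  i≮n = inj₂ (i ∸ n , sym (m+[n∸m]≡n (≮⇒≥ i≮n)))

rowSize-upper : ∀ l r i → i ≤ #nodes r →
                rowSize (node l tt r) (suc i) ≡ #nodes l + rowSize r (suc i)
rowSize-upper l r i i≤r = cong (λ j → rowSize l j + rowSize r (suc i)) (m≤n⇒m∸n≡0 i≤r)

rowSize-≤ : ∀ t i → rowSize t i ≤ #nodes t ∸ i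
rowSize-≤ t             zero    = ≤-refl
rowSize-≤ (leaf tt)     (suc i) = z≤n
rowSize-≤ (node l tt r) (suc i) with <-or-offset i (#nodes r)
... | inj₁ i<r = begin
  rowSize (node l tt r) (suc i)       ≡⟨ rowSize-upper l r i (<⇒≤ i<r) ⟩
  #nodes l + rowSize r (suc i)        ≤⟨ +-monoʳ-≤ (#nodes l) (rowSize-≤ r (suc i)) ⟩
  -- One unit is given away here, so rows 1 to `#nodes r` stay strictly below the staircase bound;
  -- row `suc (#nodes r)` attains it.
  #nodes l + (#nodes r ∸ suc i)       ≤⟨ +-monoʳ-≤ (#nodes l) (∸-monoʳ-≤ (#nodes r) (n≤1+n i)) ⟩
  #nodes l + (#nodes r ∸ i)           ≡⟨ +-∸-assoc (#nodes l) (<⇒≤ i<r) ⟨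
  (#nodes l + #nodes r) ∸ i           ≡⟨ cong (_∸ suc i) (+-suc (#nodes l) (#nodes r)) ⟨
  (#nodes l + suc (#nodes r)) ∸ suc i ∎
  where open ≤-Reasoning
... | inj₂ (j , refl) = begin
  rowSize l (#nodes r + j ∸ #nodes r) + rowSize r (suc (#nodes r + j))
    ≤⟨ +-mono-≤ (≤-reflexive (cong (rowSize l) (m+n∸m≡n (#nodes r) j))) (rowSize-≤ r (suc (#nodes r + j))) ⟩
  rowSize l j + (#nodes r ∸ suc (#nodes r + j))
    ≡⟨ cong (rowSize l j +_) (m≤n⇒m∸n≡0 (m≤n⇒m≤1+n (m≤m+n (#nodes r) j))) ⟩
  rowSize l j + 0
    ≡⟨ +-identityʳ _ ⟩
  rowSize l j
    ≤⟨ rowSize-≤ l j ⟩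
  #nodes l ∸ j
    ≡⟨ cong (_∸ j) (m+n∸n≡m (#nodes l) (suc (#nodes r))) ⟨
  (#nodes l + suc (#nodes r)) ∸ suc (#nodes r) ∸ j
    ≡⟨ ∸-+-assoc (#nodes l + suc (#nodes r)) (suc (#nodes r)) j ⟩
  (#nodes l + suc (#nodes r)) ∸ suc (#nodes r + j) ∎
  where open ≤-Reasoning

rowSize-zero : ∀ t i → #nodes t ≤ i → rowSize t i ≡ 0
rowSize-zero t i n≤i = n≤0⇒n≡0 (subst (rowSize t i ≤_) (m≤n⇒m∸n≡0 n≤i) (rowSize-≤ t i))

-- Past row `#nodes r` the right subtree contributes no cells. At `j = 0` the value is `#nodes l`;
-- this is the row of the cut.
rowSize-lower : ∀ l r j → rowSize (node l tt r) (suc (#nodes r + j)) ≡ rowSize l j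
rowSize-lower l r j = trans
  (cong₂ _+_ (cong (rowSize l) (m+n∸m≡n (#nodes r) j))
             (rowSize-zero r _ (m≤n⇒m≤1+n (m≤m+n (#nodes r) j))))
  (+-identityʳ _)

-- Counting filled cells

-- Columns are indexed from 0 here.  Dropping the condition that v be the top
-- of its segment does not change the set of covered cells, because lower nodes
-- of the segment cover fewer columns.
Covered : Shape → ℕ → ℕ → Set
Covered t i c = Σ[ v ∈ Node t ] i ≤ m-coord v × k-coord v ≤ c × m-coord v + c < #nodes t

-- Well-founded descent on `k-coord`: as long as some node of the same segment lies higher, pass to
-- it.
segmentTop : ∀ {t} (v : Node t) → Acc _<_ (k-coord v) →
  Σ[ w ∈ Node t ] m-coord w ≡ m-coord v × k-coord w ≤ k-coord v ×
    (∀ u → m-coord u ≡ m-coord w → k-coord w ≤ k-coord u)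
segmentTop {t} v (acc rs)
  with anyNode? t (λ w → (m-coord w ≟ m-coord v) ×-dec (k-coord w <? k-coord v))
... | no ¬∃ = v , refl , ≤-refl , λ u eq → ≮⇒≥ (λ k< → ¬∃ (u , eq , k<))
... | yes (w , eq , k<) with segmentTop w (rs k<)
...   | x , eq′ , k≤ , top = x , trans eq′ eq , ≤-trans k≤ (<⇒≤ k<) , top

Filled⇒Covered : ∀ {n t} i c → #nodes t ≡ n → Filled n t i (suc c) → Covered t i c
Filled⇒Covered {t = t} i c refl (v , (_ , k<n∸m , _) , (_ , i≤m) , (k<c , c≤n∸m)) =
  v , i≤m , s≤s⁻¹ (subst (_≤ suc c) (+-comm (k-coord v) 1) k<c) ,
  subst (_≤ #nodes t) (trans (+-comm (suc c) _) (+-suc _ c))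
    (m≤o∸n⇒m+n≤o (suc c) m≤n c≤n∸m)
  where
  -- A column under the segment makes the difference nonzero, so the truncated subtraction is exact.
  m≤n : m-coord v ≤ #nodes t
  m≤n = <⇒≤ (m∸n≢0⇒n<m (m<n⇒n≢0 c≤n∸m))

-- Moving to the top of the segment keeps m and can only lower k, so the cell stays covered. The
-- cell itself supplies the shelf conditions: its row `suc i` forces m to be positive, and its
-- column forces positive length.
Covered⇒Filled : ∀ {n t} i c → #nodes t ≡ n → Covered t (suc i) c → Filled n t (suc i) (suc c)
Covered⇒Filled {t = t} i c refl (v , i<m , k≤c , m+c<n)
  with segmentTop v (<-wellFounded _)
... | w , eq , k≤k , top =
  w , (≤-trans (s≤s z≤n) i<m′ , ≤-trans (s≤s k≤c′) c<n∸m , top) ,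
  (s≤s z≤n , i<m′) ,
  subst (_≤ suc c) (+-comm 1 (k-coord w)) (s≤s k≤c′) , c<n∸m
  where
  i<m′ : suc i ≤ m-coord w
  i<m′ = subst (suc i ≤_) (sym eq) i<m
  k≤c′ : k-coord w ≤ c
  k≤c′ = ≤-trans k≤k k≤c
  c<n∸m : suc c ≤ #nodes t ∸ m-coord w
  c<n∸m = m+n≤o⇒m≤o∸n (suc c)
    (subst (λ m → suc c + m ≤ #nodes t) (sym eq)
      (subst (_≤ #nodes t) (cong suc (+-comm (m-coord v) c)) m+c<n))

Covered⇒< : ∀ {t i c} → Covered t i c → c < #nodes t
Covered⇒< (v , _ , _ , m+c<n) = ≤-trans (s≤s (m≤n+m _ (m-coord v))) m+c<n

-- Nodes of `l` gain `#leaves r` in the first coordinate. This is one more than `#nodes r`, which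
-- accounts for the step from `i` to `suc i`.
Covered-left : ∀ l r i c → Covered l (i ∸ #nodes r) c → Covered (node l tt r) (suc i) c
Covered-left l r i c (v , i≤m , k≤c , m+c<n)
  = left v , i<m , k≤c , subst (_< #nodes l + suc (#nodes r)) eq (+-monoˡ-< (suc (#nodes r)) m+c<n)
  where
  eq : m-coord v + c + suc (#nodes r) ≡ m-coord v + #leaves r + c
  eq = trans (xy∙z≈xz∙y +-commutativeSemigroup (m-coord v) c (suc (#nodes r)))
             (cong (λ b → m-coord v + b + c) (sym (#leaves≡1+#nodes r)))
  i<m : suc i ≤ m-coord v + #leaves r
  i<m = begin
    suc i                              ≤⟨ s≤s (m≤n+m∸n i (#nodes r)) ⟩
    suc (#nodes r) + (i ∸ #nodes r)    ≤⟨ +-monoʳ-≤ (suc (#nodes r)) i≤m ⟩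
    suc (#nodes r) + m-coord v         ≡⟨ +-comm (suc (#nodes r)) (m-coord v) ⟩
    m-coord v + suc (#nodes r)         ≡⟨ cong (m-coord v +_) (#leaves≡1+#nodes r) ⟨
    m-coord v + #leaves r              ∎
    where open ≤-Reasoning

Covered-right : ∀ l r i c → Covered r i c → Covered (node l tt r) i (suc (#nodes l) + c)
Covered-right l r i c (v , i≤m , k≤c , m+c<n) = right v , i≤m ,
  +-mono-≤ (≤-reflexive (#leaves≡1+#nodes l)) k≤c , bound
  where
  bound : m-coord v + (suc (#nodes l) + c) < #nodes l + suc (#nodes r)
  bound = begin-strict
    m-coord v + (suc (#nodes l) + c) ≡⟨ x∙yz≈y∙xz +-commutativeSemigroup (m-coord v) (suc (#nodes l)) c ⟩
    suc (#nodes l) + (m-coord v + c) <⟨ +-monoʳ-< (suc (#nodes l)) m+c<n ⟩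
    suc (#nodes l) + #nodes r        ≡⟨ +-suc (#nodes l) (#nodes r) ⟨
    #nodes l + suc (#nodes r)        ∎
    where open ≤-Reasoning

-- The root drops out because its first coordinate is 0, below the row `suc i`.
Covered-node⁻ : ∀ l r i c → Covered (node l tt r) (suc i) c →
  Covered l (i ∸ #nodes r) c ⊎ ∃[ d ] (c ≡ suc (#nodes l) + d × Covered r (suc i) d)
Covered-node⁻ l r i c (left v , i<m , k≤c , m+c<n) = inj₁
  ( v
  , m≤n+o⇒m∸n≤o i (#nodes r) (s≤s⁻¹ (subst (suc i ≤_)
      (trans (cong (m-coord v +_) (#leaves≡1+#nodes r)) (+-comm (m-coord v) _)) i<m))
  , k≤c
  , +-cancelʳ-< (suc (#nodes r)) (m-coord v + c) (#nodes l)
      (subst (_< #nodes l + suc (#nodes r)) eq m+c<n))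
  where
  eq : m-coord v + #leaves r + c ≡ m-coord v + c + suc (#nodes r)
  eq = trans (xy∙z≈xz∙y +-commutativeSemigroup (m-coord v) (#leaves r) c)
             (cong (m-coord v + c +_) (#leaves≡1+#nodes r))
Covered-node⁻ l r i c (right v , i<m , k≤c , m+c<n)
  with m≤n⇒∃[o]m+o≡n (≤-trans (m≤m+n (#leaves l) (k-coord v)) k≤c)
... | d , refl rewrite #leaves≡1+#nodes l = inj₂
  ( d , refl , v , i<m , +-cancelˡ-≤ (suc (#nodes l)) _ _ k≤c
  , +-cancelˡ-< (suc (#nodes l)) _ _ bound)
  where
  bound : suc (#nodes l) + (m-coord v + d) < suc (#nodes l) + #nodes r
  bound = begin-strict
    suc (#nodes l) + (m-coord v + d) ≡⟨ x∙yz≈y∙xz +-commutativeSemigroup (m-coord v) (suc (#nodes l)) d ⟨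
    m-coord v + (suc (#nodes l) + d) <⟨ m+c<n ⟩
    #nodes l + suc (#nodes r)        ≡⟨ +-suc (#nodes l) (#nodes r) ⟩
    suc (#nodes l) + #nodes r        ∎
    where open ≤-Reasoning

applyUpTo-+ : ∀ {A : Set} (f : ℕ → A) m n →
              applyUpTo f (m + n) ≡ applyUpTo f m ++ applyUpTo (λ c → f (m + c)) n
applyUpTo-+ f zero    n = refl
applyUpTo-+ f (suc m) n = cong (f 0 ∷_) (applyUpTo-+ (f ∘ suc) m n)

-- `P` and the labelling `f` of columns are arbitrary so that the induction can pass to subtrees:
-- the columns of `r` start at an offset. Row 0 is full because the root covers every column there.
count-Covered : ∀ t i {P : ℕ → Set} (P? : Decidable P) (f : ℕ → ℕ) →
  (∀ c → c < #nodes t → (P (f c) → Covered t i c) × (Covered t i c → P (f c))) →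
  length (filter P? (applyUpTo f (#nodes t))) ≡ rowSize t i
count-Covered t zero P? f P⇔ = trans
  (cong length (filter-all P? (applyUpTo⁺₁ f (#nodes t) λ {c} c<n →
    proj₂ (P⇔ c c<n) (root , z≤n , z≤n , c<n))))
  (length-applyUpTo f (#nodes t))
count-Covered (leaf tt) (suc i) P? f P⇔ = refl
count-Covered (node l tt r) (suc i) {P} P? f P⇔ = begin
  length (filter P? (applyUpTo f (#nodes l + suc (#nodes r))))
    ≡⟨ cong (length ∘ filter P?) (applyUpTo-+ f (#nodes l) (suc (#nodes r))) ⟩
  length (filter P? (applyUpTo f (#nodes l) ++ f-gap ∷ applyUpTo fᵣ (#nodes r)))
    ≡⟨ cong length (filter-++ P? (applyUpTo f (#nodes l)) _) ⟩
  length (filter P? (applyUpTo f (#nodes l)) ++ filter P? (f-gap ∷ applyUpTo fᵣ (#nodes r)))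
    ≡⟨ length-++ (filter P? (applyUpTo f (#nodes l))) ⟩
  length (filter P? (applyUpTo f (#nodes l))) + length (filter P? (f-gap ∷ applyUpTo fᵣ (#nodes r)))
    ≡⟨ cong₂ _+_ (count-Covered l (i ∸ #nodes r) P? f left⇔)
         (trans (cong length (filter-reject P? ¬gap)) (count-Covered r (suc i) P? fᵣ right⇔)) ⟩
  rowSize (node l tt r) (suc i) ∎
  where
  open ≡-Reasoning
  f-gap : ℕ
  f-gap = f (#nodes l + 0)
  fᵣ : ℕ → ℕ
  fᵣ c = f (#nodes l + suc c)

  left⇔ : ∀ c → c < #nodes l →
    (P (f c) → Covered l (i ∸ #nodes r) c) × (Covered l (i ∸ #nodes r) c → P (f c))
  left⇔ c c<l = to , from ∘ Covered-left l r i c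
    where
    c<n = ≤-trans c<l (m≤m+n (#nodes l) (suc (#nodes r)))
    from = proj₂ (P⇔ c c<n)
    to : P (f c) → Covered l (i ∸ #nodes r) c
    to p with Covered-node⁻ l r i c (proj₁ (P⇔ c c<n) p)
    ... | inj₁ q = q
    ... | inj₂ (d , refl , _) = contradiction (≤-trans (n≤1+n _) c<l) (m+n≮m (#nodes l) d)

  ¬gap : ¬ P f-gap
  -- Column `#nodes l` is one too far right for `l` and one too far left for `r`.
  ¬gap p with Covered-node⁻ l r i (#nodes l + 0)
                (proj₁ (P⇔ (#nodes l + 0) (+-monoʳ-< (#nodes l) z<s)) p)
  ... | inj₁ q = m+n≮m (#nodes l) 0 (Covered⇒< q)
  ... | inj₂ (d , eq , _) with +-cancelˡ-≡ (#nodes l) 0 (suc d) (trans eq (sym (+-suc (#nodes l) d)))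
  ...   | ()

  right⇔ : ∀ c → c < #nodes r →
    (P (fᵣ c) → Covered r (suc i) c) × (Covered r (suc i) c → P (fᵣ c))
  right⇔ c c<r = to ,
    from ∘ subst (Covered (node l tt r) (suc i)) (sym (+-suc (#nodes l) c))
         ∘ Covered-right l r (suc i) c
    where
    c<n = +-monoʳ-< (#nodes l) (s≤s c<r)
    from = proj₂ (P⇔ (#nodes l + suc c) c<n)
    to : P (fᵣ c) → Covered r (suc i) c
    to p with Covered-node⁻ l r i (#nodes l + suc c) (proj₁ (P⇔ (#nodes l + suc c) c<n) p)
    ... | inj₁ q = contradiction (Covered⇒< q) (m+n≮m (#nodes l) (suc c))
    ... | inj₂ (d , eq , q)
      with +-cancelˡ-≡ (#nodes l) (suc c) (suc d) (trans eq (sym (+-suc (#nodes l) d)))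
    ...   | refl = q

rowLength≡rowSize : ∀ {n} t i → #nodes t ≡ n → rowLength n t (suc i) ≡ rowSize t (suc i)
rowLength≡rowSize {n} t i refl = count-Covered t (suc i) (filled? n t (suc i)) suc λ c _ →
  Filled⇒Covered (suc i) c refl , Covered⇒Filled i c refl

-- Injectivity

-- If #nodes r < #nodes r′, then at i = 1 + #nodes r the sum of i and the i-th
-- row attains its maximum for the first tree but not for the second.
rowSize-node-≮ : ∀ l r l′ r′ → #nodes (node l tt r) ≡ #nodes (node l′ tt r′) →
  (∀ i → rowSize (node l tt r) (suc i) ≡ rowSize (node l′ tt r′) (suc i)) →
  ¬ #nodes r < #nodes r′
rowSize-node-≮ l r l′ r′ n≡ eq r<r′ = <-irrefl n≡ (begin-strict
  #nodes l + suc (#nodes r)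
    ≡⟨ cong (_+ suc (#nodes r)) l≡ ⟩
  #nodes l′ + rowSize r′ (suc (#nodes r)) + suc (#nodes r)
    ≤⟨ +-monoˡ-≤ (suc (#nodes r)) (+-monoʳ-≤ (#nodes l′) (rowSize-≤ r′ (suc (#nodes r)))) ⟩
  #nodes l′ + (#nodes r′ ∸ suc (#nodes r)) + suc (#nodes r)
    ≡⟨ +-assoc (#nodes l′) _ _ ⟩
  #nodes l′ + (#nodes r′ ∸ suc (#nodes r) + suc (#nodes r))
    ≡⟨ cong (#nodes l′ +_) (m∸n+n≡m r<r′) ⟩
  #nodes l′ + #nodes r′
    <⟨ +-monoʳ-< (#nodes l′) ≤-refl ⟩
  #nodes l′ + suc (#nodes r′) ∎)
  where
  open ≤-Reasoning
  l≡ : #nodes l ≡ #nodes l′ + rowSize r′ (suc (#nodes r))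
  l≡ = trans (sym (rowSize-lower l r 0))
      (trans (eq (#nodes r + 0))
      (trans (cong (λ j → rowSize (node l′ tt r′) (suc j)) (+-identityʳ (#nodes r)))
             (rowSize-upper l′ r′ (#nodes r) (<⇒≤ r<r′))))

-- Applying `rowSize-node-≮` in both directions shows that the cuts agree. The rows from the cut on
-- determine `l`; cancelling its contribution in every row leaves the rows of `r`.
rowSize-injective : ∀ t t′ → #nodes t ≡ #nodes t′ →
  (∀ i → rowSize t (suc i) ≡ rowSize t′ (suc i)) → t ≡ t′
rowSize-injective (leaf tt) (leaf tt) _ _ = refl
rowSize-injective (leaf tt) (node l′ tt r′) n≡ _ = contradiction (trans n≡ (+-suc (#nodes l′) _)) 0≢1+n
rowSize-injective (node l tt r) (leaf tt) n≡ _ = contradiction (trans (sym n≡) (+-suc (#nodes l) _)) 0≢1+n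
rowSize-injective (node l tt r) (node l′ tt r′) n≡ eq = cong₂ (λ x y → node x tt y)
  (rowSize-injective l l′ l≡ (eqˡ ∘ suc)) (rowSize-injective r r′ r≡ eqʳ)
  where
  r≡ : #nodes r ≡ #nodes r′
  r≡ = ≤-antisym (≮⇒≥ (rowSize-node-≮ l′ r′ l r (sym n≡) (sym ∘ eq)))
                 (≮⇒≥ (rowSize-node-≮ l r l′ r′ n≡ eq))

  eqˡ : ∀ j → rowSize l j ≡ rowSize l′ j
  eqˡ j = trans (sym (rowSize-lower l r j))
         (trans (eq (#nodes r + j))
         (trans (cong (λ n → rowSize (node l′ tt r′) (suc (n + j))) r≡)
                (rowSize-lower l′ r′ j)))

  -- Row 0 is the node count, so the row at the cut compares the sizes of the left subtrees.
  l≡ : #nodes l ≡ #nodes l′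
  l≡ = eqˡ 0

  eqʳ : ∀ i → rowSize r (suc i) ≡ rowSize r′ (suc i)
  eqʳ i = +-cancelˡ-≡ _ _ _
    (trans (eq i) (cong (_+ rowSize r′ (suc i))
      (trans (cong (λ n → rowSize l′ (i ∸ n)) (sym r≡)) (sym (eqˡ (i ∸ #nodes r))))))

-- Surjectivity

least : ∀ {P : ℕ → Set} → Decidable P → ∀ n → P n →
        ∃[ q ] (q ≤ n × P q × (∀ i → i < q → ¬ P i))
least P? n pn with P? 0
... | yes p0 = 0 , z≤n , p0 , λ _ ()
least P? zero    pn | no ¬p0 = contradiction pn ¬p0
least P? (suc n) pn | no ¬p0 with least (P? ∘ suc) n pn
... | q , q≤n , pq , below = suc q , s≤s q≤n , pq , λ
  { zero _ → ¬p0 ; (suc i) (s≤s i<q) → below i i<q }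

antitone : ∀ {h : ℕ → ℕ} → (∀ i → h (suc i) ≤ h i) → ∀ i j → h (i + j) ≤ h i
antitone {h} dec i zero    = ≤-reflexive (cong h (+-identityʳ i))
antitone {h} dec i (suc j) =
  ≤-trans (≤-reflexive (cong h (+-suc i j))) (≤-trans (dec (i + j)) (antitone dec i j))

-- Strong induction on the size. For size `suc n`, cut at the least `q` with `h q + q ≡ n`: the rows
-- after `q` give a left subtree with `h q` nodes, and the first `q` rows, shortened by `h q`, give
-- a right subtree with `q` nodes.
rowSize-surjective : ∀ n → Acc _<_ n → (h : ℕ → ℕ) → (∀ i → h (suc i) ≤ h i) →
  (∀ i → h i ≤ n ∸ suc i) →
  Σ[ t ∈ Shape ] #nodes t ≡ n × (∀ i → rowSize t (suc i) ≡ h i)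
rowSize-surjective zero    _        h dec bound = leaf tt , refl , λ i → sym (n≤0⇒n≡0 (bound i))
rowSize-surjective (suc n) (acc rs) h dec bound
  -- The search ends at `n` at the latest, since the bound forces `h n` to be 0.
  with least (λ q → h q + q ≟ n) n (cong (_+ n) (n≤0⇒n≡0 (subst (h n ≤_) (n∸n≡0 n) (bound n))))
... | q , q≤n , hq+q≡n , below
  -- Row `q` itself is left out: its length `h q` becomes row 0 of the left subtree.
  with rowSize-surjective (h q) (rs (s≤s hq≤n)) (λ i → h (suc q + i))
         (λ i → ≤-trans (≤-reflexive (cong h (+-suc (suc q) i))) (dec (suc q + i))) boundˡ
     | rowSize-surjective q (rs (s≤s q≤n)) (λ i → h i ∸ h q)
         (λ i → ∸-monoˡ-≤ (h q) (dec i)) boundʳ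
  where
  hq≤n : h q ≤ n
  hq≤n = subst (h q ≤_) hq+q≡n (m≤m+n (h q) q)

  boundˡ : ∀ i → h (suc q + i) ≤ h q ∸ suc i
  boundˡ i = begin
    h (suc q + i)         ≤⟨ bound (suc q + i) ⟩
    n ∸ suc (q + i)       ≡⟨ cong (n ∸_) (+-suc q i) ⟨
    n ∸ (q + suc i)       ≡⟨ ∸-+-assoc n q (suc i) ⟨
    n ∸ q ∸ suc i         ≡⟨ cong (λ m → m ∸ q ∸ suc i) hq+q≡n ⟨
    h q + q ∸ q ∸ suc i   ≡⟨ cong (_∸ suc i) (m+n∸n≡m (h q) q) ⟩
    h q ∸ suc i           ∎
    where open ≤-Reasoning

  boundʳ : ∀ i → h i ∸ h q ≤ q ∸ suc i
  boundʳ i with <-or-offset i q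
  -- Minimality of `q` makes `h i + i ≤ n` strict. The unit gained over `bound i` is what the
  -- staircase of size `q` requires.
  ... | inj₁ i<q = m≤n+o⇒m∸n≤o (h i) (h q) (begin
    h i                     ≤⟨ m+n≤o⇒m≤o∸n (h i) (subst (_≤ n) (sym (+-suc (h i) i)) (≤∧≢⇒< hi+i≤n (below i i<q))) ⟩
    n ∸ suc i               ≡⟨ cong (_∸ suc i) hq+q≡n ⟨
    h q + q ∸ suc i         ≡⟨ +-∸-assoc (h q) i<q ⟩
    h q + (q ∸ suc i)       ∎)
    where
    open ≤-Reasoning
    hi+i≤n : h i + i ≤ n
    hi+i≤n = m≤o∸n⇒m+n≤o (h i) (≤-trans (<⇒≤ i<q) q≤n) (bound i)
  ... | inj₂ (j , refl) = ≤-trans (≤-reflexive (m≤n⇒m∸n≡0 (antitone dec q j))) z≤n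
... | l , l≡ , eqˡ | r , r≡ , eqʳ = node l tt r ,
  trans (cong₂ (λ a b → a + suc b) l≡ r≡) (trans (+-suc (h q) q) (cong suc hq+q≡n)) , rows
  where
  rows : ∀ i → rowSize (node l tt r) (suc i) ≡ h i
  rows i with <-or-offset i q
  ... | inj₁ i<q = trans (rowSize-upper l r i (subst (i ≤_) (sym r≡) (<⇒≤ i<q)))
    (trans (cong₂ _+_ l≡ (eqʳ i)) (m+[n∸m]≡n hq≤hi))
    where
    hq≤hi : h q ≤ h i
    hq≤hi = subst (λ m → h m ≤ h i) (m+[n∸m]≡n (<⇒≤ i<q)) (antitone dec i (q ∸ i))
  ... | inj₂ (j , refl) = trans (cong (λ m → rowSize (node l tt r) (suc (m + j))) (sym r≡))
                                (trans (rowSize-lower l r j) (lower j))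
    where
    lower : ∀ j → rowSize l j ≡ h (q + j)
    lower zero    = trans l≡ (cong h (sym (+-identityʳ q)))
    lower (suc j) = trans (eqˡ j) (cong h (sym (+-suc q j)))

-- `Fits` speaks only of rows 0 to `n`. It makes row `n` empty, and monotonicity carries this to all
-- later rows, where the truncated bound is 0.
Fits⇒≤ : ∀ {n} μ → Fits (suc n) μ → ∀ i → row μ i ≤ suc n ∸ suc i
Fits⇒≤ {n} μ fits i with <-or-offset i n
... | inj₁ i<n        = m+n≤o⇒m≤o∸n (row μ i) (fits i (m≤n⇒m≤1+n i<n))
... | inj₂ (j , refl) =
  ≤-trans (antitone (decreasing μ) n j)
    (≤-trans (m+n≤o⇒m≤o∸n (row μ n) (fits n ≤-refl))
      (≤-trans (≤-reflexive (n∸n≡0 n)) z≤n))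

-- Transfer from row sizes to the bookshelf map

mainTheorem1 : (n : ℕ) → 1 ≤ n →
    (Σ[ fits ∈ ((T : BinaryTree n) → Fits n (B T)) ]
    Bijective _≡_ (_≈ᶠ_ {n}) (λ (T : BinaryTree n) → (B T , fits T)))
    × ((μ : YoungDiagram) → Fits n μ → (i : ℕ) → n ≤ suc i → row μ i ≡ 0)
mainTheorem1 (suc n) _ = (fits , injective , surjective) , vanishing
  where
  size : (T : BinaryTree (suc n)) → #nodes (proj₁ T) ≡ suc n
  size (t , leaves) = suc-injective (trans (sym (#leaves≡1+#nodes t)) leaves)

  row-B : (T : BinaryTree (suc n)) → ∀ i → row (B T) i ≡ rowSize (proj₁ T) (suc i)
  row-B T i = rowLength≡rowSize (proj₁ T) i (size T)

  fits : (T : BinaryTree (suc n)) → Fits (suc n) (B T)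
  fits T i i<n = m≤o∸n⇒m+n≤o (row (B T) i) i<n (begin
    row (B T) i                 ≡⟨ row-B T i ⟩
    rowSize (proj₁ T) (suc i)   ≤⟨ rowSize-≤ (proj₁ T) (suc i) ⟩
    #nodes (proj₁ T) ∸ suc i    ≡⟨ cong (_∸ suc i) (size T) ⟩
    suc n ∸ suc i               ∎)
    where open ≤-Reasoning

  injective : {S T : BinaryTree (suc n)} → B S ≈ B T → S ≡ T
  injective {S@(s , p)} {T@(t , q)} eq
    with rowSize-injective s t (trans (size S) (sym (size T)))
           (λ i → trans (sym (row-B S i)) (trans (eq i) (row-B T i)))
  ... | refl = cong (s ,_) (≡-irrelevant p q)

  surjective : ((μ , _) : FittingDiagram (suc n)) →
    ∃[ T ] (∀ {S : BinaryTree (suc n)} → S ≡ T → B S ≈ μ)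
  surjective (μ , fits-μ)
    with rowSize-surjective (suc n) (<-wellFounded _) (row μ) (decreasing μ) (Fits⇒≤ μ fits-μ)
  ... | t , nodes , rows = T , λ { refl i → trans (row-B T i) (rows i) }
    where
    T : BinaryTree (suc n)
    T = t , trans (#leaves≡1+#nodes t) (cong suc nodes)

  vanishing : (μ : YoungDiagram) → Fits (suc n) μ → ∀ i → suc n ≤ suc i → row μ i ≡ 0
  vanishing μ fits-μ i n≤i =
    n≤0⇒n≡0 (subst (row μ i ≤_) (m≤n⇒m∸n≡0 n≤i) (Fits⇒≤ μ fits-μ i))
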